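{- Let $\Gamma$ and $\Gamma'$ be $z$-knotted triangulations. Then: (1) If $F$ is a face of $\Gamma$ with $M_F=D_F$, then for every face $F'$ of $\Gamma'$ and every special homeomorphism $g:\partial F\to\partial F'$ the connected sum $\Gamma\#_g\Gamma'$ is $z$-knotted. (2) Suppose $F$ is a face of $\Gamma$ with $M_F$ the identity. If $F'$ is a face of $\Gamma'$ such that $\Gamma\#_g\Gamma'$ is $z$-knotted for some special homeomorphism $g:\partial F\to\partial F'$, then $M_{F'}$ is $D_{F'}$ or of type (M3). In these cases, $\Gamma\#_g\Gamma'$ is $z$-knotted for every special homeomorphism $g:\partial F\to\partial F'$. (3) If $F$ is a face of $\Gamma$, $F'$ is a face of $\Gamma'$, and each of $M_F,M_{F'}$ is of type (M3) or (M4), then there is a special homeomorphism $g:\partial F\to\partial F'$ such that $\Gamma\#_g\Gamma'$ is $z$-knotted.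
   Context: A triangulation is a connected simple finite graph embedded in a connected closed $2$-dimensional surface such that every face (closure of a component of the complement) is a closed $2$-disc with exactly three edges, every edge lies in exactly two distinct faces, and two distinct faces meet in an edge, a vertex, or not at all. Two distinct edges are adjacent if they share a vertex and lie in a common face. A zigzag is a sequence of edges $(e_i)_{i\in\mathbb N}$ with $e_i,e_{i+1}$ adjacent and the face containing $e_i,e_{i+1}$ distinct from the face containing $e_{i+1},e_{i+2}$, for all $i$; it is periodic and regarded as a cyclic sequence; written as a cyclic sequence of vertices, each passage through an edge has a direction (oriented edge). Its reverse is also a zigzag. A triangulation is $z$-knotted if it has exactly one pair of zigzags $\{Z,Z^{ -1}\}$. For a face $F$ with vertices $a,b,c$, $\Omega(F)=\{ab,bc,ca,ac,cb,ba\}$ (oriented edges), $-e$ denotes the reverse of $e$, and $D_F=(ab,bc,ca)(ac,cb,ba)$. The $z$-monodromy $M_F$ of $\Omega(F)$: for $e\in\Omega(F)$ take $e_0$ with $D_F(e_0)=e$ and the zigzag $Z$ containing consecutive oriented edges $e_0,e$; $M_F(e)$ is the first element of $\Omega(F)$ occurring in $Z$ after $e$. Type (M3): $M_F=(-e_1,e_2,e_3)(-e_3,-e_2,e_1)$ where $(e_1,e_2,e_3)$ is one of the cycles of $D_F$. Type (M4): $M_F=(e_1,-e_2)(e_2,-e_1)$ where $(e_1,e_2,e_3)$ is one of the cycles of $D_F$ ($e_3,-e_3$ fixed). For faces $F$ of $\Gamma$ and $F'$ of $\Gamma'$, a special homeomorphism $g:\partial F\to\partial F'$ is a homeomorphism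 sending vertices to vertices; the connected sum $\Gamma\#_g\Gamma'$ is obtained by removing the interiors of $F,F'$ and gluing the boundaries via $g$ (vertices $v$ and $g(v)$ identified, corresponding edges identified); it is a triangulation of the connected sum of the surfaces. -}

module Defs where

open import Level using (0ℓ)
open import Data.Nat using (ℕ)
open import Data.Fin using (Fin; zero; suc)
open import Data.Fin.Properties using (_≟_)
open import Data.Product using (Σ; Σ-syntax; _×_; _,_; proj₁; proj₂)
open import Data.Sum using (_⊎_; inj₁; inj₂)
open import Relation.Nullary using (¬_; yes; no)
open import Relation.Binary.PropositionalEquality using (_≡_; _≢_)
open import Relation.Binary.Construct.Closure.ReflexiveTransitive using (Star)

-- Raw face structures: a vertex type V and a (symmetric) face predicate.
-- A "state" (u , v , w) with Face u v w is a pair of consecutive oriented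
-- edges u→v , v→w of a zigzag lying in the common face {u,v,w}.

Tri : Set → Set
Tri V = V × V × V

mid : {V : Set} → Tri V → V
mid (_ , v , _) = v

lst : {V : Set} → Tri V → V
lst (_ , _ , w) = w

IsFlag : {V : Set} → (V → V → V → Set) → Tri V → Set
IsFlag Face (u , v , w) = Face u v w

Next : {V : Set} → (V → V → V → Set) → Tri V → Tri V → Set
Next Face (u , v , w) (v' , w' , x) = v' ≡ v × w' ≡ w × Face v w x × x ≢ u

rev : {V : Set} → Tri V → Tri V
rev (u , v , w) = (w , v , u)

-- z-knotted: exactly one pair {Z , Z⁻¹} of zigzags, i.e. there is a flag s
-- such that every flag lies on the zigzag through s or on its reverse
zKnotted : {V : Set} → (V → V → V → Set) → Set
zKnotted {V} Face =
  Σ[ s ∈ Tri V ] (IsFlag Face s ×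
    ((t : Tri V) → IsFlag Face t → Star (Next Face) s t ⊎ Star (Next Face) (rev s) t))

InTri : {V : Set} → V → V → V → V → Set
InTri a b c x = x ≡ a ⊎ x ≡ b ⊎ x ≡ c

InΩ : {V : Set} → V → V → V → V → V → Set
InΩ a b c q r = InTri a b c q × InTri a b c r × q ≢ r

data Hit {V : Set} (Face : V → V → V → Set) (a b c : V) : Tri V → Tri V → Set where
  stop : ∀ {s t} → Next Face s t → InΩ a b c (mid t) (lst t) → Hit Face a b c s t
  go   : ∀ {s u t} → Next Face s u → ¬ InΩ a b c (mid u) (lst u) →
         Hit Face a b c u t → Hit Face a b c s t

-- the six oriented edges of F, with vertices v₀ = a, v₁ = b, v₂ = c:
-- fwd i = vᵢ → vᵢ₊₁ ,  bwd i = vᵢ₊₁ → vᵢ  (indices mod 3)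
data Ω6 : Set where
  fwd bwd : Fin 3 → Ω6

s3 : Fin 3 → Fin 3
s3 zero = suc zero
s3 (suc zero) = suc (suc zero)
s3 (suc (suc zero)) = zero

p3 : Fin 3 → Fin 3
p3 zero = suc (suc zero)
p3 (suc zero) = zero
p3 (suc (suc zero)) = suc zero

vtx : {V : Set} → V → V → V → Fin 3 → V
vtx a b c zero = a
vtx a b c (suc zero) = b
vtx a b c (suc (suc zero)) = c

tailΩ headΩ thirdΩ : {V : Set} → V → V → V → Ω6 → V
tailΩ a b c (fwd i) = vtx a b c i
tailΩ a b c (bwd i) = vtx a b c (s3 i)
headΩ a b c (fwd i) = vtx a b c (s3 i)
headΩ a b c (bwd i) = vtx a b c i
thirdΩ a b c (fwd i) = vtx a b c (s3 (s3 i))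
thirdΩ a b c (bwd i) = vtx a b c (s3 (s3 i))

-- D_F = (ab,bc,ca)(ac,cb,ba)
D : Ω6 → Ω6
D (fwd i) = fwd (s3 i)
D (bwd i) = bwd (p3 i)

neg : Ω6 → Ω6
neg (fwd i) = bwd i
neg (bwd i) = fwd i

-- Mon Face a b c e e' :  M_F(e) = e'.  The zigzag through the consecutive
-- oriented edges e₀ , e (D_F e₀ = e) is the one through the state
-- (third e , tail e , head e); M_F(e) is the first element of Ω(F) after e.
Mon : {V : Set} → (V → V → V → Set) → V → V → V → Ω6 → Ω6 → Set
Mon {V} Face a b c e e' =
  Σ[ t ∈ Tri V ] (Hit Face a b c (thirdΩ a b c e , tailΩ a b c e , headΩ a b c e) t
                  × mid t ≡ tailΩ a b c e' × lst t ≡ headΩ a b c e')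

MisD : {V : Set} → (V → V → V → Set) → V → V → V → Set
MisD Face a b c = (e : Ω6) → Mon Face a b c e (D e)

MisId : {V : Set} → (V → V → V → Set) → V → V → V → Set
MisId Face a b c = (e : Ω6) → Mon Face a b c e e

TypeM3 : {V : Set} → (V → V → V → Set) → V → V → V → Set
TypeM3 Face a b c = Σ[ e₁ ∈ Ω6 ]
  (let M = Mon Face a b c ; e₂ = D e₁ ; e₃ = D e₂ in
     M (neg e₁) e₂ × M e₂ e₃ × M e₃ (neg e₁)
   × M (neg e₃) (neg e₂) × M (neg e₂) e₁ × M e₁ (neg e₃))

TypeM4 : {V : Set} → (V → V → V → Set) → V → V → V → Set
TypeM4 Face a b c = Σ[ e₁ ∈ Ω6 ]
  (let M = Mon Face a b c ; e₂ = D e₁ ; e₃ = D e₂ in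
     M e₁ (neg e₂) × M (neg e₂) e₁ × M e₂ (neg e₁) × M (neg e₁) e₂
   × M e₃ e₃ × M (neg e₃) (neg e₃))

record Triangulation : Set₁ where
  field
    n        : ℕ
    Face     : Fin n → Fin n → Fin n → Set
    distinct : ∀ {a b c} → Face a b c → a ≢ b × b ≢ c × c ≢ a
    rotate   : ∀ {a b c} → Face a b c → Face b c a
    swap     : ∀ {a b c} → Face a b c → Face b a c
    edge-two : ∀ {a b c} → Face a b c →
               Σ[ d ∈ Fin n ] (d ≢ c × Face a b d × ((e : Fin n) → Face a b e → e ≡ c ⊎ e ≡ d))
    nonempty : Σ[ t ∈ Tri (Fin n) ] IsFlag Face t
    connected : (x y : Fin n) → Star (λ u v → Σ[ z ∈ Fin n ] Face u v z) x y
    -- the link of every vertex is a single cycle (surface condition)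
    link-connected : ∀ v u w u' w' → Face v u w → Face v u' w' → Star (Face v) u u'

open Triangulation

-- Connected sum Γ #_g Γ' along F = {a,b,c} of Γ and F' = {p,q,r} of Γ',
-- where g : a ↦ p , b ↦ q , c ↦ r.  Vertices: Fin n ⊎ Fin n', a vertex x
-- of F' being identified with g⁻¹(x) ∈ Fin n (the copies inj₂ p , inj₂ q ,
-- inj₂ r lie on no face and are irrelevant).

embed' : {n n' : ℕ} → Fin n → Fin n → Fin n → Fin n' → Fin n' → Fin n' →
         Fin n' → Fin n ⊎ Fin n'
embed' a b c p q r x with x ≟ p
... | yes _ = inj₁ a
... | no _ with x ≟ q
...   | yes _ = inj₁ b
...   | no _ with x ≟ r
...     | yes _ = inj₁ c
...     | no _ = inj₂ x

SumFace : (Γ Γ' : Triangulation) → (a b c : Fin (n Γ)) → (p q r : Fin (n Γ')) →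
          Fin (n Γ) ⊎ Fin (n Γ') → Fin (n Γ) ⊎ Fin (n Γ') → Fin (n Γ) ⊎ Fin (n Γ') → Set
SumFace Γ Γ' a b c p q r x y z =
    (Σ[ t ∈ Tri (Fin (n Γ)) ] (IsFlag (Face Γ) t
       × ¬ (InTri a b c (proj₁ t) × InTri a b c (mid t) × InTri a b c (lst t))
       × x ≡ inj₁ (proj₁ t) × y ≡ inj₁ (mid t) × z ≡ inj₁ (lst t)))
  ⊎ (Σ[ t ∈ Tri (Fin (n Γ')) ] (IsFlag (Face Γ') t
       × ¬ (InTri p q r (proj₁ t) × InTri p q r (mid t) × InTri p q r (lst t))
       × x ≡ embed' a b c p q r (proj₁ t) × y ≡ embed' a b c p q r (mid t)
       × z ≡ embed' a b c p q r (lst t)))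

ZKnotted : Triangulation → Set
ZKnotted Γ = zKnotted (Face Γ)

SameTri : {V : Set} → V → V → V → V → V → V → Set
SameTri p q r p' q' r' = InTri p q r p' × InTri p q r q' × InTri p q r r'

{-# OPTIONS --safe #-}
module Submission where

-- Cutting Γ along ∂F leaves a piece whose zigzag arcs run from boundary edge to boundary edge;
-- sending the edge where an arc enters to the edge where it exits is M_F, while for the single
-- triangle F the same map is D_F.  Gluing two pieces with maps M and N along a triangle produces
-- the 12 boundary crossings (edge, side entered), permuted by e ↦ M e from the left and e ↦ N e
-- from the right.  The glued surface is z-knotted iff every zigzag crosses the boundary and the
-- crossings form one orbit up to reversal.  Applied to Γ = (Γ ∖ F) ∪ F this says
-- that (M_F, D) has one orbit up to reversal; applied to Γ # Γ' it concerns (M_F, M_F').  As M_F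
-- satisfies M(-M e) = -e and M e ≠ -e, what remains is a finite computation on six edges; in
-- part (3) a cyclic relabelling of F' always suffices.

open import Defs
open import Data.Bool using (if_then_else_)
open import Data.Empty using (⊥; ⊥-elim)
open import Data.Fin using (Fin; zero; suc; combine; join; splitAt; toℕ)
open import Data.Fin.Properties using (_≟_; pigeonhole; combine-injective; splitAt-join; any?; all?; toℕ≤pred[n])
open import Data.List using (List; []; _∷_; iterate; map)
open import Data.List.Membership.Propositional using (_∈_)
open import Data.List.Relation.Unary.All as All using (All; []; _∷_)
open import Data.List.Relation.Unary.Any using (here; there)
open import Data.Nat using (ℕ; zero; suc; _≤_; _<_; z≤n; s≤s)
open import Data.Nat.Properties using (m≤n⇒m<n∨m≡n; n<1+n)
open import Data.Product using (Σ; Σ-syntax; _×_; _,_; proj₁; proj₂; uncurry)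
open import Data.Sum using (_⊎_; inj₁; inj₂)
import Data.Sum as Sum
open import Data.Sum.Properties using (inj₁-injective; inj₂-injective; ≡-dec)
open import Function using (_∘_; id)
open import Relation.Binary.Construct.Closure.ReflexiveTransitive using (Star; ε; _◅_; _◅◅_; gmap)
open import Relation.Binary.PropositionalEquality using (_≡_; _≢_; refl; sym; trans; cong; cong₂; subst; subst₂)
open import Relation.Nullary using (¬_; Dec; yes; no; does; _×-dec_; _⊎-dec_; _→-dec_; ¬?)
open import Relation.Nullary.Decidable using (map′; toWitness)
open Triangulation using (n; Face)

-- Finite types and orbits of relations on them.

record Finite (V : Set) : Set where
  field
    size      : ℕ
    code      : V → Fin size
    code-inj  : ∀ {x y} → code x ≡ code y → x ≡ y

open Finite

finite-Fin : (m : ℕ) → Finite (Fin m)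
finite-Fin m = record { size = m ; code = id ; code-inj = id }

finite-⊎ : {m k : ℕ} → Finite (Fin m ⊎ Fin k)
finite-⊎ {m} {k} = record
  { code = join m k
  ; code-inj = λ {x} {y} eq → trans (sym (splitAt-join m k x)) (trans (cong (splitAt m) eq) (splitAt-join m k y)) }

finite-Tri : {V : Set} → Finite V → Finite (Tri V)
finite-Tri {V} fin = record
  { code = λ (x , y , z) → combine (code fin x) (combine (code fin y) (code fin z))
  ; code-inj = inj }
  where
  inj : {s t : Tri V} →
        combine (code fin (proj₁ s)) (combine (code fin (mid s)) (code fin (lst s)))
        ≡ combine (code fin (proj₁ t)) (combine (code fin (mid t)) (code fin (lst t))) → s ≡ t
  inj {x , y , z} {x' , y' , z'} eq
    with e₁ , e ← combine-injective (code fin x) _ (code fin x') _ eq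
    with e₂ , e₃ ← combine-injective (code fin y) (code fin z) (code fin y') (code fin z') e
    with refl ← code-inj fin e₁ | refl ← code-inj fin e₂ | refl ← code-inj fin e₃ = refl

module _ {X : Set} (R : X → X → Set) where

  Iter : ℕ → X → X → Set
  Iter zero s t = s ≡ t
  Iter (suc k) s t = Σ[ u ∈ X ] (Iter k s u × R u t)

  iter-star : ∀ k {s t} → Iter k s t → Star R s t
  iter-star zero refl = ε
  iter-star (suc k) (_ , p , r) = iter-star k p ◅◅ r ◅ ε

  star-iter : ∀ {s t u} k → Iter k s t → Star R t u → Σ[ j ∈ ℕ ] Iter j s u
  star-iter k p ε = k , p
  star-iter k p (r ◅ rs) = star-iter (suc k) (_ , p , r) rs

  iter-prefix : ∀ {i k s t} → i ≤ k → Iter k s t → Σ[ u ∈ X ] Iter i s u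
  iter-prefix {k = zero} z≤n p = _ , p
  iter-prefix {k = suc k} i≤k p with m≤n⇒m<n∨m≡n i≤k
  ... | inj₂ refl = _ , p
  ... | inj₁ (s≤s i≤k') = iter-prefix i≤k' (proj₁ (proj₂ p))

  iter-head : ∀ k {s t} → Iter (suc k) s t → Σ[ u ∈ X ] (R s u × Iter k u t)
  iter-head zero (_ , refl , r) = _ , r , refl
  iter-head (suc k) (_ , p , r) with u , r₀ , q ← iter-head k p = u , r₀ , _ , q , r

-- Backward determinism pulls the first repetition of an orbit back to its start.
module Orbits {X : Set} (R : X → X → Set) (Ok T : X → Set) (fin : Finite X)
  (ok-step : ∀ {s t} → R s t → Ok t)
  (backward : ∀ {s s' t} → Ok s → Ok s' → R s t → R s' t → s ≡ s')
  (progress : ∀ {s} → Ok s → (Σ[ t ∈ X ] R s t) ⊎ T s) where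

  iter-ok : ∀ k {s t} → Ok s → Iter R k s t → Ok t
  iter-ok zero o refl = o
  iter-ok (suc k) o (_ , _ , r) = ok-step r

  walk : ∀ k {s} → Ok s → (Σ[ t ∈ X ] (T t × Star R s t)) ⊎ (Σ[ t ∈ X ] Iter R k s t)
  walk zero o = inj₂ (_ , refl)
  walk (suc k) o with walk k o
  ... | inj₁ q = inj₁ q
  ... | inj₂ (t , p) with progress (iter-ok k o p)
  ...   | inj₁ (u , r) = inj₂ (u , t , p , r)
  ...   | inj₂ end = inj₁ (t , end , iter-star R k p)

  cancel : ∀ i j {s t} → i < j → Ok s → Iter R i s t → Iter R j s t → Σ[ u ∈ X ] (Star R s u × R u s)
  cancel zero (suc j) _ o refl (u , p , r) = u , iter-star R j p , r
  cancel (suc i) (suc j) (s≤s i<j) o (u , p , r) (u' , p' , r')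
    with refl ← backward (iter-ok i o p) (iter-ok j o p') r r' = cancel i j i<j o p p'

  ends-or-returns : ∀ {s} → Ok s → (Σ[ t ∈ X ] (T t × Star R s t)) ⊎ (Σ[ t ∈ X ] (Star R s t × R t s))
  ends-or-returns {s} o with walk (size fin) o
  ... | inj₁ q = inj₁ q
  ... | inj₂ (_ , p) = inj₂ returns
    where
    at : (i : Fin (suc (size fin))) → Σ[ u ∈ X ] Iter R (toℕ i) s u
    at i = iter-prefix R (toℕ≤pred[n] i) p
    returns : Σ[ t ∈ X ] (Star R s t × R t s)
    -- The positions 0 to `size fin` outnumber the codes by one, so two of them carry the same
    -- state.
    returns with i , j , i<j , eq ← pigeonhole (n<1+n _) (code fin ∘ proj₁ ∘ at) =
      cancel (toℕ i) (toℕ j) i<j o (proj₂ (at i)) (subst (Iter R (toℕ j) s) (sym (code-inj fin eq)) (proj₂ (at j)))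

-- Faces, zigzag steps and reversal.

record FaceSystem {V : Set} (Face : V → V → V → Set) : Set where
  field
    distinct    : ∀ {a b c} → Face a b c → a ≢ b × b ≢ c × c ≢ a
    rotate      : ∀ {a b c} → Face a b c → Face b c a
    swap        : ∀ {a b c} → Face a b c → Face b a c
    -- Only an upper bound, so that it also holds in a piece with boundary, whose border edges lie
    -- in a single face.
    at-most-two : ∀ {a b c d e} → Face a b c → Face a b d → Face a b e → d ≢ c → e ≢ c → d ≡ e

  next-flag : ∀ {s t} → Next Face s t → IsFlag Face t
  next-flag (refl , refl , f , _) = f

  star-flag : ∀ {s t} → IsFlag Face s → Star (Next Face) s t → IsFlag Face t
  star-flag f ε = f
  star-flag f (r ◅ rs) = star-flag (next-flag r) rs

  rev-flag : ∀ {s} → IsFlag Face s → IsFlag Face (rev s)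
  rev-flag f = swap (rotate f)

  next-det : ∀ {s t t'} → IsFlag Face s → Next Face s t → Next Face s t' → t ≡ t'
  next-det f (refl , refl , g , x≢) (refl , refl , g' , x'≢) =
    cong (λ x → _ , _ , x) (at-most-two (rotate f) g g' x≢ x'≢)

  next-rev : ∀ {s t} → IsFlag Face s → Next Face s t → Next Face (rev t) (rev s)
  next-rev f (refl , refl , _ , x≢) = refl , refl , rev-flag f , x≢ ∘ sym

  -- Reversal turns backward steps into forward ones, so this is determinism of the reversed zigzag.
  next-backward : ∀ {s s' t} → IsFlag Face s → IsFlag Face s' → Next Face s t → Next Face s' t → s ≡ s'
  next-backward f f' r r' = cong rev (next-det (rev-flag (next-flag r)) (next-rev f r) (next-rev f' r'))

  star-rev : ∀ {s t} → IsFlag Face s → Star (Next Face) s t → Star (Next Face) (rev t) (rev s)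
  star-rev f ε = ε
  star-rev f (r ◅ rs) = star-rev (next-flag r) rs ◅◅ next-rev f r ◅ ε

  -- A path from s to rev s is a palindrome, and neither of its two possible midpoints exists.
  iter-reverse : ∀ k {s} → IsFlag Face s → ¬ Iter (Next Face) k s (rev s)
  iter-reverse zero f eq = proj₂ (proj₂ (distinct f)) (sym (cong proj₁ eq))
  iter-reverse (suc zero) f (_ , refl , eq , _) = proj₁ (proj₂ (distinct f)) (sym eq)
  iter-reverse (suc (suc k)) f (u' , p , r')
    with u , r , q ← iter-head (Next Face) k p
    with refl ← next-det f r (next-rev (star-flag f (iter-star _ (suc k) p)) r') =
      iter-reverse k (next-flag r) q

  star-reverse : ∀ {s} → IsFlag Face s → ¬ Star (Next Face) s (rev s)
  star-reverse f p with k , q ← star-iter _ 0 refl p = iter-reverse k f q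

  module ClosedSystem (fin : Finite V)
    (other : ∀ {a b c} → Face a b c → Σ[ d ∈ V ] (d ≢ c × Face a b d)) where

    progress : ∀ {s} → IsFlag Face s → (Σ[ t ∈ Tri V ] Next Face s t) ⊎ ⊥
    progress {u , v , w} f with x , x≢ , g ← other (rotate f) = inj₁ ((v , w , x) , refl , refl , g , x≢)

    open Orbits (Next Face) (IsFlag Face) (λ _ → ⊥) (finite-Tri fin) next-flag next-backward progress

    -- By determinism the closed zigzag through `s` leaves `s` by this very step; the rest of the
    -- cycle leads from `t` back to `s`.
    next-returns : ∀ {s t} → IsFlag Face s → Next Face s t → Star (Next Face) t s
    next-returns f r with ends-or-returns f
    ... | inj₂ (_ , ε , r') = subst (λ x → Star _ x _) (next-det f r' r) ε
    ... | inj₂ (_ , (r₀ ◅ p) , r') = subst (λ x → Star _ x _) (next-det f r₀ r) (p ◅◅ r' ◅ ε)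

    star-returns : ∀ {s t} → IsFlag Face s → Star (Next Face) s t → Star (Next Face) t s
    star-returns f ε = ε
    star-returns f (r ◅ rs) = star-returns (next-flag r) rs ◅◅ next-returns f r

    -- Zigzags are closed, so one can travel from `f` back to the given base flag and on to `t`. If
    -- `f` and `t` are reached from opposite directions of the base, reversing the path to `f` gives
    -- a path that starts at `rev f`.
    knotted-any : zKnotted Face → ∀ {f t} → IsFlag Face f → IsFlag Face t →
                  Star (Next Face) f t ⊎ Star (Next Face) (rev f) t
    knotted-any (s , fs , all) {f} {t} ff ft with all f ff | all t ft
    ... | inj₁ p | inj₁ q = inj₁ (star-returns fs p ◅◅ q)
    ... | inj₂ p | inj₂ q = inj₁ (star-returns (rev-flag fs) p ◅◅ q)
    ... | inj₁ p | inj₂ q = inj₂ (star-rev fs p ◅◅ q)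
    ... | inj₂ p | inj₁ q = inj₂ (star-rev (rev-flag fs) p ◅◅ q)

-- Pieces bordered by a triangle and the zigzag arcs that cross them.

neg-neg : ∀ e → neg (neg e) ≡ e
neg-neg (fwd _) = refl
neg-neg (bwd _) = refl

-- The boundary is a triangle whose oriented edge e runs from tl e to tl (neg e).
record Bordered {V : Set} (Face : V → V → V → Set) (tl : Ω6 → V) : Set where
  field
    faceSystem  : FaceSystem Face
    continue    : ∀ {a b c} → Face a b c →
                  (Σ[ d ∈ V ] (d ≢ c × Face a b d)) ⊎ (Σ[ e ∈ Ω6 ] (a ≡ tl e × b ≡ tl (neg e)))
    apex        : Ω6 → V
    apex-face   : ∀ e → Face (tl e) (tl (neg e)) (apex e)
    apex-unique : ∀ e {x} → Face (tl e) (tl (neg e)) x → x ≡ apex e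
    tl-inj      : ∀ {e e'} → tl e ≡ tl e' → tl (neg e) ≡ tl (neg e') → e ≡ e'

  open FaceSystem faceSystem public

  -- `enter e` is the first state inside the piece after a zigzag passes `e` inwards; `exit e` is
  -- the last state inside before it passes `e` outwards.
  enter exit : Ω6 → Tri V
  enter e = tl e , tl (neg e) , apex e
  exit e = apex e , tl e , tl (neg e)

  Crosses : Ω6 → Ω6 → Set
  Crosses e e' = Star (Next Face) (enter e) (exit e')

  flag-exit : ∀ {s} e → IsFlag Face s → mid s ≡ tl e → lst s ≡ tl (neg e) → s ≡ exit e
  flag-exit e f refl refl = cong (_, tl e , tl (neg e)) (apex-unique e (rotate f))

  rev-enter : ∀ e → rev (enter e) ≡ exit (neg e)
  rev-enter e = flag-exit (neg e) (rev-flag (apex-face e)) refl (cong tl (sym (neg-neg e)))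

  rev-exit : ∀ e → rev (exit e) ≡ enter (neg e)
  rev-exit e = trans (cong (rev ∘ exit) (sym (neg-neg e))) (cong rev (sym (rev-enter (neg e))))

  exit-stuck : ∀ e {t} → ¬ Next Face (exit e) t
  exit-stuck e (refl , refl , f , x≢) = x≢ (apex-unique e f)

  enter-source : ∀ e {s} → IsFlag Face s → ¬ Next Face s (enter e)
  enter-source e f r = exit-stuck (neg e) (subst (λ x → Next Face x _) (rev-enter e) (next-rev f r))

  enter-inj : ∀ {e e'} → enter e ≡ enter e' → e ≡ e'
  enter-inj eq = tl-inj (cong proj₁ eq) (cong mid eq)

  exit-inj : ∀ {e e'} → exit e ≡ exit e' → e ≡ e'
  exit-inj eq = tl-inj (cong mid eq) (cong lst eq)

  enter-only : ∀ {s} e → IsFlag Face s → Star (Next Face) s (enter e) → s ≡ enter e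
  enter-only e f ε = refl
  enter-only e f (r ◅ rs) with refl ← enter-only e (next-flag r) rs = ⊥-elim (enter-source e f r)

  stuck-unique : ∀ {s t t'} → IsFlag Face s → (∀ {x} → ¬ Next Face t x) → (∀ {x} → ¬ Next Face t' x) →
                 Star (Next Face) s t → Star (Next Face) s t' → t ≡ t'
  stuck-unique f stuck stuck' ε ε = refl
  stuck-unique f stuck stuck' ε (r ◅ _) = ⊥-elim (stuck r)
  stuck-unique f stuck stuck' (r ◅ _) ε = ⊥-elim (stuck' r)
  stuck-unique f stuck stuck' (r ◅ p) (r' ◅ p') with refl ← next-det f r r' = stuck-unique (next-flag r) stuck stuck' p p'

  crosses-functional : ∀ e {e₁ e₂} → Crosses e e₁ → Crosses e e₂ → e₁ ≡ e₂
  crosses-functional e {e₁} {e₂} p q = exit-inj (stuck-unique (apex-face e) (exit-stuck e₁) (exit-stuck e₂) p q)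

  -- The arc is traversed backwards. In terms of the map M that sends entry to exit this is M(-M e)
  -- = -e.
  crosses-neg : ∀ e e' → Crosses e e' → Crosses (neg e') (neg e)
  crosses-neg e e' p = subst₂ (Star (Next Face)) (rev-exit e') (rev-enter e) (star-rev (apex-face e) p)

  -- Such an arc would lead from a state to its own reverse.
  crosses-not-neg : ∀ e → ¬ Crosses e (neg e)
  crosses-not-neg e p = star-reverse (apex-face e) (subst (Star (Next Face) (enter e)) (sym (rev-enter e)) p)

  -- In a finite piece the path from `enter e` either reaches the border or comes back to `enter e`;
  -- the latter is impossible because `enter e` has no predecessor in the piece.
  crosses-total : Finite V → ∀ e → Σ[ e' ∈ Ω6 ] Crosses e e'
  crosses-total fin e with ends-or-returns {enter e} (apex-face e)
    where
    progress : ∀ {s} → IsFlag Face s → (Σ[ t ∈ Tri V ] Next Face s t) ⊎ (Σ[ e' ∈ Ω6 ] s ≡ exit e')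
    progress {u , v , w} f with continue (rotate f)
    ... | inj₁ (x , x≢ , g) = inj₁ ((v , w , x) , refl , refl , g , x≢)
    ... | inj₂ (e' , v≡ , w≡) = inj₂ (e' , flag-exit e' f v≡ w≡)
    open Orbits (Next Face) (IsFlag Face) (λ s → Σ[ e' ∈ Ω6 ] s ≡ exit e') (finite-Tri fin) next-flag next-backward progress
  ... | inj₁ (_ , (e' , refl) , p) = e' , p
  ... | inj₂ (_ , p , r) = ⊥-elim (enter-source e (star-flag (apex-face e) p) r)

  -- Excludes closed zigzags that stay in the piece and never meet its border.
  Full : Set
  Full = ∀ {t} → IsFlag Face t → Σ[ e ∈ Ω6 ] Star (Next Face) (enter e) t

-- Crossings of the border and the gluing of two pieces.

-- inj₁ e: crossing e into the left piece; inj₂ e: crossing e into the right piece.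
Crossing : Set
Crossing = Ω6 ⊎ Ω6

turn : (Ω6 → Ω6) → (Ω6 → Ω6) → Crossing → Crossing
turn M N (inj₁ e) = inj₂ (M e)
turn M N (inj₂ e) = inj₁ (N e)

-- Passing the same edge in the other direction leads into the other piece, hence the change of
-- side.
opposite : Crossing → Crossing
opposite (inj₁ e) = inj₂ (neg e)
opposite (inj₂ e) = inj₁ (neg e)

Reach : (Ω6 → Ω6) → (Ω6 → Ω6) → Crossing → Crossing → Set
Reach M N = Star (λ c d → turn M N c ≡ d)

-- One orbit of crossings up to reversal, based at `c`.
Spans : (Ω6 → Ω6) → (Ω6 → Ω6) → Crossing → Set
Spans M N c = ∀ d → Reach M N c d ⊎ Reach M N (opposite c) d

reach-swap : ∀ {M N} {c d : Crossing} → Reach M N c d → Reach N M (Sum.swap c) (Sum.swap d)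
reach-swap = gmap Sum.swap λ { {inj₁ _} refl → refl ; {inj₂ _} refl → refl }

spans-swap : ∀ {M N e} → Spans M N (inj₁ e) → Spans N M (inj₂ e)
spans-swap sp (inj₁ e) = Sum.map reach-swap reach-swap (sp (inj₂ e))
spans-swap sp (inj₂ e) = Sum.map reach-swap reach-swap (sp (inj₁ e))

-- Facts about the left piece inside the glued surface. The hypotheses are symmetric, so the gluing
-- instantiates this twice, with the sides exchanged.
module OneSide {W : Set} {LF RF Face : W → W → W → Set} {tl : Ω6 → W}
  (BL : Bordered LF tl) (BR : Bordered RF tl)
  (inL : ∀ {x y z} → LF x y z → Face x y z) (inR : ∀ {x y z} → RF x y z → Face x y z)
  (out : ∀ {x y z} → Face x y z → LF x y z ⊎ RF x y z)
  (disjoint : ∀ {x y z} → LF x y z → ¬ RF x y z)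
  (shared : ∀ {x y z z'} → LF x y z → RF x y z' → Σ[ e ∈ Ω6 ] (x ≡ tl e × y ≡ tl (neg e))) where

  private
    module L = Bordered BL
    module R = Bordered BR

  next-in : ∀ {s t} → Next LF s t → Next Face s t
  next-in (p , q , f , x≢) = p , q , inL f , x≢

  star-in : ∀ {s t} → Star (Next LF) s t → Star (Next Face) s t
  star-in = gmap id next-in

  switch : ∀ e → Next Face (L.exit e) (R.enter e)
  switch e = refl , refl , inR (R.apex-face e) ,
    λ eq → disjoint (L.apex-face e) (subst (RF (tl e) (tl (neg e))) eq (R.apex-face e))

  cross-over : ∀ {e e'} → L.Crosses e e' → Star (Next Face) (L.enter e) (R.enter e')
  cross-over {e' = e'} p = star-in p ◅◅ switch e' ◅ ε

  rev-enter-next : ∀ e → Next Face (rev (L.enter e)) (R.enter (neg e))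
  rev-enter-next e = subst (λ s → Next Face s (R.enter (neg e))) (sym (L.rev-enter e)) (switch (neg e))

  next-out : ∀ {s t} → IsFlag LF s → Next Face s t → Next LF s t ⊎ (Σ[ e ∈ Ω6 ] (s ≡ L.exit e × t ≡ R.enter e))
  next-out f (refl , refl , g , x≢) with out g
  ... | inj₁ g' = inj₁ (refl , refl , g' , x≢)
  ... | inj₂ g' with shared (L.rotate f) g'
  ...   | e , refl , refl = inj₂ (e , L.flag-exit e f refl refl , cong (λ x → _ , _ , x) (R.apex-unique e g'))

  -- If a right face lies on the edge, it is a border edge with one face on each side; a second left
  -- face would then equal the first, so both remaining faces are right faces and coincide.
  third-face : ∀ {a b c d e} → LF a b c → Face a b d → Face a b e → d ≢ c → e ≢ c → d ≡ e
  third-face f g h d≢ e≢ with out g | out h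
  ... | inj₁ g' | inj₁ h' = L.at-most-two f g' h' d≢ e≢
  ... | inj₁ g' | inj₂ h' with x , refl , refl ← shared f h' =
    ⊥-elim (d≢ (trans (L.apex-unique x g') (sym (L.apex-unique x f))))
  ... | inj₂ g' | inj₁ h' with x , refl , refl ← shared f g' =
    ⊥-elim (e≢ (trans (L.apex-unique x h') (sym (L.apex-unique x f))))
  ... | inj₂ g' | inj₂ h' with x , refl , refl ← shared f g' = trans (R.apex-unique x g') (sym (R.apex-unique x h'))

  other-face : ∀ {a b c} → LF a b c → Σ[ d ∈ W ] (d ≢ c × Face a b d)
  other-face {c = c} f with L.continue f
  ... | inj₁ (d , d≢ , g) = d , d≢ , inL g
  ... | inj₂ (e , refl , refl) =
    R.apex e , (λ eq → disjoint f (subst (RF (tl e) (tl (neg e))) eq (R.apex-face e))) , inR (R.apex-face e)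

module Glue {W : Set} {LF RF Face : W → W → W → Set} {tl : Ω6 → W} (fin : Finite W)
  (BL : Bordered LF tl) (BR : Bordered RF tl)
  (inL : ∀ {x y z} → LF x y z → Face x y z) (inR : ∀ {x y z} → RF x y z → Face x y z)
  (out : ∀ {x y z} → Face x y z → LF x y z ⊎ RF x y z)
  (disjoint : ∀ {x y z} → LF x y z → ¬ RF x y z)
  (shared : ∀ {x y z z'} → LF x y z → RF x y z' → Σ[ e ∈ Ω6 ] (x ≡ tl e × y ≡ tl (neg e)))
  (M N : Ω6 → Ω6)
  (crossL : ∀ e → Bordered.Crosses BL e (M e)) (crossR : ∀ e → Bordered.Crosses BR e (N e)) where

  private
    module L = Bordered BL
    module R = Bordered BR
    module LR = OneSide BL BR inL inR out disjoint shared
    module RL = OneSide BR BL inR inL (Sum.swap ∘ out) (λ f g → disjoint g f) (λ f g → shared g f)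

  faceSystem : FaceSystem Face
  faceSystem = record
    { distinct = λ f → Sum.[ L.distinct , R.distinct ] (out f)
    ; rotate = λ f → Sum.[ inL ∘ L.rotate , inR ∘ R.rotate ] (out f)
    ; swap = λ f → Sum.[ inL ∘ L.swap , inR ∘ R.swap ] (out f)
    ; at-most-two = λ f → Sum.[ LR.third-face , RL.third-face ] (out f)
    }

  open FaceSystem faceSystem
  open ClosedSystem fin (λ f → Sum.[ LR.other-face , RL.other-face ] (out f))

  at : Crossing → Tri W
  at (inj₁ e) = L.enter e
  at (inj₂ e) = R.enter e

  at-flag : ∀ c → IsFlag Face (at c)
  at-flag (inj₁ e) = inL (L.apex-face e)
  at-flag (inj₂ e) = inR (R.apex-face e)

  rev-at : ∀ c → Next Face (rev (at c)) (at (opposite c))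
  rev-at (inj₁ e) = LR.rev-enter-next e
  rev-at (inj₂ e) = RL.rev-enter-next e

  -- The states that a zigzag meets from the crossing `c` up to its next crossing.
  Stretch : Crossing → Tri W → Set
  Stretch (inj₁ e) = Star (Next LF) (L.enter e)
  Stretch (inj₂ e) = Star (Next RF) (R.enter e)

  stretch-star : ∀ c {t} → Stretch c t → Star (Next Face) (at c) t
  stretch-star (inj₁ _) = LR.star-in
  stretch-star (inj₂ _) = RL.star-in

  reach-star : ∀ {c d} → Reach M N c d → Star (Next Face) (at c) (at d)
  reach-star ε = ε
  reach-star {inj₁ e} (refl ◅ p) = LR.cross-over (crossL e) ◅◅ reach-star p
  reach-star {inj₂ e} (refl ◅ p) = RL.cross-over (crossR e) ◅◅ reach-star p

  -- A step within the piece prolongs the stretch. A step out of it starts at an exit state, which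
  -- ends the arc, so the new crossing is the `turn` of the old one.
  stretch-next : ∀ c {s t} → Stretch c s → Next Face s t → Σ[ d ∈ Crossing ] (Reach M N c d × Stretch d t)
  stretch-next (inj₁ e) p r with LR.next-out (L.star-flag (L.apex-face e) p) r
  ... | inj₁ r' = inj₁ e , ε , p ◅◅ r' ◅ ε
  ... | inj₂ (e' , refl , refl) with refl ← L.crosses-functional e (crossL e) p = inj₂ e' , refl ◅ ε , ε
  stretch-next (inj₂ e) p r with RL.next-out (R.star-flag (R.apex-face e) p) r
  ... | inj₁ r' = inj₂ e , ε , p ◅◅ r' ◅ ε
  ... | inj₂ (e' , refl , refl) with refl ← R.crosses-functional e (crossR e) p = inj₁ e' , refl ◅ ε , ε

  trace : ∀ c {s t} → Stretch c s → Star (Next Face) s t → Σ[ d ∈ Crossing ] (Reach M N c d × Stretch d t)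
  trace c p ε = c , ε , p
  trace c p (r ◅ rs) with d , q , p' ← stretch-next c p r with d' , q' , p'' ← trace d p' rs = d' , q ◅◅ q' , p''

  stretch-refl : ∀ c → Stretch c (at c)
  stretch-refl (inj₁ _) = ε
  stretch-refl (inj₂ _) = ε

  -- An entering state has no predecessor in its own piece, so a stretch that ends at one is empty.
  stretch-enter : ∀ c d → Stretch c (at d) → c ≡ d
  stretch-enter (inj₁ e) (inj₁ e') p = cong inj₁ (L.enter-inj (L.enter-only e' (L.apex-face e) p))
  stretch-enter (inj₂ e) (inj₂ e') p = cong inj₂ (R.enter-inj (R.enter-only e' (R.apex-face e) p))
  stretch-enter (inj₁ e) (inj₂ e') p = ⊥-elim (disjoint (L.star-flag (L.apex-face e) p) (R.apex-face e'))
  stretch-enter (inj₂ e) (inj₁ e') p = ⊥-elim (disjoint (L.apex-face e') (R.star-flag (R.apex-face e) p))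

  star-reach : ∀ {c d} → Star (Next Face) (at c) (at d) → Reach M N c d
  star-reach {c} {d} p with d' , q , p' ← trace c (stretch-refl c) p = subst (Reach M N c) (stretch-enter d' d p') q

  -- `rev (at c)` comes one step before `at (opposite c)` on a closed zigzag, so the second base can
  -- be moved to that crossing.
  from-crossing : zKnotted Face → ∀ c {t} → IsFlag Face t →
                  Star (Next Face) (at c) t ⊎ Star (Next Face) (at (opposite c)) t
  from-crossing k c f = Sum.map₂ (next-returns (rev-flag (at-flag c)) (rev-at c) ◅◅_) (knotted-any k (at-flag c) f)

  knotted⇒spans : zKnotted Face → ∀ c → Spans M N c
  knotted⇒spans k c d = Sum.map star-reach star-reach (from-crossing k c (at-flag d))

  -- When the surface is z-knotted, every flag is reached from one fixed crossing or its opposite;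
  -- the last crossing on the way begins the stretch.
  on-stretch : zKnotted Face → ∀ {t} → IsFlag Face t → Σ[ c ∈ Crossing ] Stretch c t
  on-stretch k f with from-crossing k (inj₁ (fwd zero)) f
  ... | inj₁ p with d , _ , q ← trace (inj₁ (fwd zero)) ε p = d , q
  ... | inj₂ p with d , _ , q ← trace (inj₂ (bwd zero)) ε p = d , q

  knotted⇒fullL : zKnotted Face → L.Full
  knotted⇒fullL k f with on-stretch k (inL f)
  ... | inj₁ e , p = e , p
  ... | inj₂ e , p = ⊥-elim (disjoint f (R.star-flag (R.apex-face e) p))

  spans⇒knotted : L.Full → R.Full → ∀ c → Spans M N c → zKnotted Face
  spans⇒knotted fullL fullR c sp = at c , at-flag c , λ t f → reached (stretch f)
    where
    stretch : ∀ {t} → IsFlag Face t → Σ[ d ∈ Crossing ] Stretch d t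
    stretch f with out f
    ... | inj₁ g = let e , p = fullL g in inj₁ e , p
    ... | inj₂ g = let e , p = fullR g in inj₂ e , p
    reached : ∀ {t} → Σ[ d ∈ Crossing ] Stretch d t → Star (Next Face) (at c) t ⊎ Star (Next Face) (rev (at c)) t
    reached (d , p) with sp d
    ... | inj₁ q = inj₁ (reach-star q ◅◅ stretch-star d p)
    ... | inj₂ q = inj₂ (rev-at c ◅ reach-star q ◅◅ stretch-star d p)

-- Images of a piece under an injective map of vertices.

module Transport {V W : Set} {LF : V → V → V → Set} {tl : Ω6 → V} (B : Bordered LF tl)
  (ι : V → W) (ι-inj : ∀ {x y} → ι x ≡ ι y → x ≡ y)
  (tlW : Ω6 → W) (tlW≡ : ∀ e → tlW e ≡ ι (tl e)) where

  private module B = Bordered B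

  Image : W → W → W → Set
  Image x y z = Σ[ t ∈ Tri V ] (IsFlag LF t × x ≡ ι (proj₁ t) × y ≡ ι (mid t) × z ≡ ι (lst t))

  ι³ : Tri V → Tri W
  ι³ (x , y , z) = ι x , ι y , ι z

  image : ∀ {x y z} → LF x y z → Image (ι x) (ι y) (ι z)
  image f = _ , f , refl , refl , refl

  faceSystem : FaceSystem Image
  faceSystem = record
    { distinct = λ { (_ , f , refl , refl , refl) → let p , q , r = B.distinct f in p ∘ ι-inj , q ∘ ι-inj , r ∘ ι-inj }
    ; rotate = λ { (_ , f , refl , refl , refl) → image (B.rotate f) }
    ; swap = λ { (_ , f , refl , refl , refl) → image (B.swap f) }
    ; at-most-two = at-most-two
    }
    where
    at-most-two : ∀ {a b c d e} → Image a b c → Image a b d → Image a b e → d ≢ c → e ≢ c → d ≡ e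
    at-most-two (_ , f , refl , refl , refl) (_ , g , p , q , refl) (_ , h , p' , q' , refl) d≢ e≢
      with refl ← ι-inj p | refl ← ι-inj q | refl ← ι-inj p' | refl ← ι-inj q' =
        cong ι (B.at-most-two f g h (d≢ ∘ cong ι) (e≢ ∘ cong ι))

  -- The border carries the labelling `tlW` because both pieces of a connected sum must share one
  -- labelling, with which the image of `tl` agrees only propositionally.
  bordered : Bordered Image tlW
  bordered = record
    { faceSystem = faceSystem
    ; continue = continue
    ; apex = ι ∘ B.apex
    ; apex-face = λ e → _ , B.apex-face e , tlW≡ e , tlW≡ (neg e) , refl
    ; apex-unique = apex-unique
    ; tl-inj = λ {e} {e'} p q → B.tl-inj (tl-eq e e' p) (tl-eq (neg e) (neg e') q)
    }
    where
    tl-eq : ∀ e e' → tlW e ≡ tlW e' → tl e ≡ tl e'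
    tl-eq e e' p = ι-inj (trans (sym (tlW≡ e)) (trans p (tlW≡ e')))
    continue : ∀ {a b c} → Image a b c →
               (Σ[ d ∈ W ] (d ≢ c × Image a b d)) ⊎ (Σ[ e ∈ Ω6 ] (a ≡ tlW e × b ≡ tlW (neg e)))
    continue (_ , f , refl , refl , refl) with B.continue f
    ... | inj₁ (d , d≢ , g) = inj₁ (ι d , d≢ ∘ ι-inj , image g)
    ... | inj₂ (e , refl , refl) = inj₂ (e , sym (tlW≡ e) , sym (tlW≡ (neg e)))
    apex-unique : ∀ e {x} → Image (tlW e) (tlW (neg e)) x → x ≡ ι (B.apex e)
    apex-unique e (_ , f , p , q , refl)
      with refl ← ι-inj (trans (sym (tlW≡ e)) p) | refl ← ι-inj (trans (sym (tlW≡ (neg e))) q) =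
        cong ι (B.apex-unique e f)

  module I = Bordered bordered

  star-image : ∀ {s t} → Star (Next LF) s t → Star (Next Image) (ι³ s) (ι³ t)
  star-image = gmap ι³ λ { (refl , refl , f , x≢) → refl , refl , image f , x≢ ∘ ι-inj }

  enter-image : ∀ e → ι³ (B.enter e) ≡ I.enter e
  enter-image e = cong₂ (λ x y → x , y , I.apex e) (sym (tlW≡ e)) (sym (tlW≡ (neg e)))

  exit-image : ∀ e → ι³ (B.exit e) ≡ I.exit e
  exit-image e = cong₂ (λ x y → I.apex e , x , y) (sym (tlW≡ e)) (sym (tlW≡ (neg e)))

  crosses-image : ∀ e e' → B.Crosses e e' → I.Crosses e e'
  crosses-image e e' p = subst₂ (Star (Next Image)) (enter-image e) (exit-image e') (star-image p)

  full-image : B.Full → I.Full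
  full-image full (t , f , refl , refl , refl) =
    let e , p = full f in e , subst (λ s → Star (Next Image) s (ι³ t)) (enter-image e) (star-image p)

-- Edges and vertices of a labelled triangle.

-- The edge e runs from vertex number start e to vertex number start (neg e).
start : Ω6 → Fin 3
start (fwd i) = i
start (bwd i) = s3 i

opp : Ω6 → Fin 3
opp (fwd i) = s3 (s3 i)
opp (bwd i) = s3 (s3 i)

-- Junk on the diagonal.
edge : Fin 3 → Fin 3 → Ω6
edge zero zero = fwd zero
edge zero (suc zero) = fwd zero
edge zero (suc (suc zero)) = bwd (suc (suc zero))
edge (suc zero) zero = bwd zero
edge (suc zero) (suc zero) = fwd zero
edge (suc zero) (suc (suc zero)) = fwd (suc zero)
edge (suc (suc zero)) zero = fwd (suc (suc zero))
edge (suc (suc zero)) (suc zero) = bwd (suc zero)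
edge (suc (suc zero)) (suc (suc zero)) = fwd zero

edge-start : ∀ e → edge (start e) (start (neg e)) ≡ e
edge-start (fwd zero) = refl
edge-start (fwd (suc zero)) = refl
edge-start (fwd (suc (suc zero))) = refl
edge-start (bwd zero) = refl
edge-start (bwd (suc zero)) = refl
edge-start (bwd (suc (suc zero))) = refl

start-edge : ∀ i j → i ≢ j → start (edge i j) ≡ i × start (neg (edge i j)) ≡ j
start-edge zero zero i≢j = ⊥-elim (i≢j refl)
start-edge zero (suc zero) _ = refl , refl
start-edge zero (suc (suc zero)) _ = refl , refl
start-edge (suc zero) zero _ = refl , refl
start-edge (suc zero) (suc zero) i≢j = ⊥-elim (i≢j refl)
start-edge (suc zero) (suc (suc zero)) _ = refl , refl
start-edge (suc (suc zero)) zero _ = refl , refl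
start-edge (suc (suc zero)) (suc zero) _ = refl , refl
start-edge (suc (suc zero)) (suc (suc zero)) i≢j = ⊥-elim (i≢j refl)

corners : ∀ e i → i ≡ start e ⊎ i ≡ start (neg e) ⊎ i ≡ opp e
corners (fwd i) j = around i j
  where
  around : ∀ i j → j ≡ i ⊎ j ≡ s3 i ⊎ j ≡ s3 (s3 i)
  around zero zero = inj₁ refl
  around zero (suc zero) = inj₂ (inj₁ refl)
  around zero (suc (suc zero)) = inj₂ (inj₂ refl)
  around (suc zero) zero = inj₂ (inj₂ refl)
  around (suc zero) (suc zero) = inj₁ refl
  around (suc zero) (suc (suc zero)) = inj₂ (inj₁ refl)
  around (suc (suc zero)) zero = inj₂ (inj₁ refl)
  around (suc (suc zero)) (suc zero) = inj₂ (inj₂ refl)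
  around (suc (suc zero)) (suc (suc zero)) = inj₁ refl
corners (bwd i) j with corners (fwd i) j
... | inj₁ p = inj₂ (inj₁ p)
... | inj₂ (inj₁ p) = inj₁ p
... | inj₂ (inj₂ p) = inj₂ (inj₂ p)

module _ {V : Set} (a b c : V) where

  vtx-in : ∀ i → InTri a b c (vtx a b c i)
  vtx-in zero = inj₁ refl
  vtx-in (suc zero) = inj₂ (inj₁ refl)
  vtx-in (suc (suc zero)) = inj₂ (inj₂ refl)

  in-vtx : ∀ {x} → InTri a b c x → Σ[ i ∈ Fin 3 ] x ≡ vtx a b c i
  in-vtx (inj₁ p) = zero , p
  in-vtx (inj₂ (inj₁ p)) = suc zero , p
  in-vtx (inj₂ (inj₂ p)) = suc (suc zero) , p

  vtx-inj : a ≢ b × b ≢ c × c ≢ a → ∀ i j → vtx a b c i ≡ vtx a b c j → i ≡ j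
  vtx-inj _ zero zero _ = refl
  vtx-inj (a≢b , _) zero (suc zero) p = ⊥-elim (a≢b p)
  vtx-inj (_ , _ , c≢a) zero (suc (suc zero)) p = ⊥-elim (c≢a (sym p))
  vtx-inj (a≢b , _) (suc zero) zero p = ⊥-elim (a≢b (sym p))
  vtx-inj _ (suc zero) (suc zero) _ = refl
  vtx-inj (_ , b≢c , _) (suc zero) (suc (suc zero)) p = ⊥-elim (b≢c p)
  vtx-inj (_ , _ , c≢a) (suc (suc zero)) zero p = ⊥-elim (c≢a p)
  vtx-inj (_ , b≢c , _) (suc (suc zero)) (suc zero) p = ⊥-elim (b≢c (sym p))
  vtx-inj _ (suc (suc zero)) (suc (suc zero)) _ = refl

  tl : Ω6 → V
  tl e = vtx a b c (start e)

  tailΩ-tl : ∀ e → tailΩ a b c e ≡ tl e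
  tailΩ-tl (fwd _) = refl
  tailΩ-tl (bwd _) = refl

  headΩ-tl : ∀ e → headΩ a b c e ≡ tl (neg e)
  headΩ-tl (fwd _) = refl
  headΩ-tl (bwd _) = refl

  thirdΩ-opp : ∀ e → thirdΩ a b c e ≡ vtx a b c (opp e)
  thirdΩ-opp (fwd _) = refl
  thirdΩ-opp (bwd _) = refl

  in-edge : ∀ {x y} → InTri a b c x → InTri a b c y → x ≢ y → Σ[ e ∈ Ω6 ] (x ≡ tl e × y ≡ tl (neg e))
  in-edge x∈ y∈ x≢y with i , refl ← in-vtx x∈ | j , refl ← in-vtx y∈
    with p , q ← start-edge i j (x≢y ∘ cong (vtx a b c)) =
      edge i j , cong (vtx a b c) (sym p) , cong (vtx a b c) (sym q)

  in-corner : ∀ e {x} → InTri a b c x → x ≡ tl e ⊎ x ≡ tl (neg e) ⊎ x ≡ vtx a b c (opp e)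
  in-corner e x∈ with i , refl ← in-vtx x∈ =
    Sum.map (cong (vtx a b c)) (Sum.map (cong (vtx a b c)) (cong (vtx a b c))) (corners e i)

-- Cutting a triangulation along a face.

module Cut (Γ : Triangulation) {a b c : Fin (n Γ)} (F : Face Γ a b c) where

  private
    V = Fin (n Γ)
    module Γ = Triangulation Γ

  InF : V → Set
  InF = InTri a b c

  inF? : ∀ x → Dec (InF x)
  inF? x = (x ≟ a) ⊎-dec (x ≟ b) ⊎-dec (x ≟ c)

  τ : Ω6 → V
  τ = tl a b c

  third : Ω6 → V
  third e = vtx a b c (opp e)

  τ-inj : ∀ {e e'} → τ e ≡ τ e' → τ (neg e) ≡ τ (neg e') → e ≡ e'
  τ-inj {e} {e'} p q = trans (sym (edge-start e))
    (trans (cong₂ edge (inj (start e) (start e') p) (inj (start (neg e)) (start (neg e')) q)) (edge-start e'))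
    where inj = vtx-inj a b c (Γ.distinct F)

  AllInF : V → V → V → Set
  AllInF x y z = InF x × InF y × InF z

  allInF? : ∀ x y z → Dec (AllInF x y z)
  allInF? x y z = inF? x ×-dec inF? y ×-dec inF? z

  F-face : ∀ e → Face Γ (τ e) (τ (neg e)) (third e)
  F-face (fwd i) = rotated i
    where
    rotated : ∀ i → Face Γ (τ (fwd i)) (τ (bwd i)) (third (fwd i))
    rotated zero = F
    rotated (suc zero) = Γ.rotate F
    rotated (suc (suc zero)) = Γ.rotate (Γ.rotate F)
  F-face (bwd i) = Γ.swap (F-face (fwd i))

  -- The vertices of a face are distinct, so a face with all three among `a`, `b`, `c` is `F`
  -- itself.
  Outer Inner : V → V → V → Set
  Outer x y z = Face Γ x y z × ¬ AllInF x y z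
  Inner x y z = Face Γ x y z × AllInF x y z

  at-most-two : ∀ {x y z z₁ z₂} → Face Γ x y z → Face Γ x y z₁ → Face Γ x y z₂ → z₁ ≢ z → z₂ ≢ z → z₁ ≡ z₂
  at-most-two {z₁ = z₁} {z₂} f g h p q with _ , _ , _ , only ← Γ.edge-two f with only z₁ g | only z₂ h
  ... | inj₁ r | _ = ⊥-elim (p r)
  ... | inj₂ _ | inj₁ r = ⊥-elim (q r)
  ... | inj₂ r | inj₂ r' = trans r (sym r')

  τ∈ : ∀ e → InF (τ e)
  τ∈ e = vtx-in a b c (start e)

  inner-apex : ∀ e {x} → Inner (τ e) (τ (neg e)) x → x ≡ third e
  inner-apex e (f , _ , _ , x∈) with in-corner a b c e x∈
  ... | inj₁ p = ⊥-elim (proj₂ (proj₂ (Γ.distinct f)) p)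
  ... | inj₂ (inj₁ p) = ⊥-elim (proj₁ (proj₂ (Γ.distinct f)) (sym p))
  ... | inj₂ (inj₂ p) = p

  outer-apex≢third : ∀ e {x} → Outer (τ e) (τ (neg e)) x → x ≢ third e
  outer-apex≢third e (_ , ¬F) refl = ¬F (τ∈ e , τ∈ (neg e) , vtx-in a b c (opp e))

  beyond : ∀ e {x} → Face Γ (τ e) (τ (neg e)) x → x ≢ third e → Outer (τ e) (τ (neg e)) x
  beyond e f x≢ = f , λ all → x≢ (inner-apex e (f , all))

  opposite-face : ∀ e → Σ[ x ∈ V ] Outer (τ e) (τ (neg e)) x
  opposite-face e with x , x≢ , f , _ ← Γ.edge-two (F-face e) = x , beyond e f x≢

  outer : Bordered Outer τ
  outer = record
    { faceSystem = record
      { distinct = Γ.distinct ∘ proj₁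
      ; rotate = λ (f , ¬F) → Γ.rotate f , λ (y , z , x) → ¬F (x , y , z)
      ; swap = λ (f , ¬F) → Γ.swap f , λ (y , x , z) → ¬F (x , y , z)
      ; at-most-two = λ (f , _) (g , _) (h , _) → at-most-two f g h
      }
    ; continue = continue
    ; apex = proj₁ ∘ opposite-face
    ; apex-face = proj₂ ∘ opposite-face
    ; apex-unique = λ e f → at-most-two (F-face e) (proj₁ f) (proj₁ (proj₂ (opposite-face e)))
        (outer-apex≢third e f) (outer-apex≢third e (proj₂ (opposite-face e)))
    ; tl-inj = τ-inj
    }
    where
    continue : ∀ {x y z} → Outer x y z →
               (Σ[ d ∈ V ] (d ≢ z × Outer x y d)) ⊎ (Σ[ e ∈ Ω6 ] (x ≡ τ e × y ≡ τ (neg e)))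
    continue {x} {y} (f , _) with inF? x ×-dec inF? y
    -- Any two distinct vertices of `F` are joined by a side of `F`, so this edge lies on the
    -- border.
    ... | yes (x∈ , y∈) = inj₂ (in-edge a b c x∈ y∈ (proj₁ (Γ.distinct f)))
    ... | no ¬xy with d , d≢ , g , _ ← Γ.edge-two f = inj₁ (d , d≢ , g , λ (x∈ , y∈ , _) → ¬xy (x∈ , y∈))

  inner : Bordered Inner τ
  inner = record
    { faceSystem = record
      { distinct = Γ.distinct ∘ proj₁
      ; rotate = λ (f , x , y , z) → Γ.rotate f , y , z , x
      ; swap = λ (f , x , y , z) → Γ.swap f , y , x , z
      ; at-most-two = λ (f , _) (g , _) (h , _) → at-most-two f g h
      }
    ; continue = λ (f , x∈ , y∈ , _) → inj₂ (in-edge a b c x∈ y∈ (proj₁ (Γ.distinct f)))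
    ; apex = third
    ; apex-face = λ e → F-face e , τ∈ e , τ∈ (neg e) , vtx-in a b c (opp e)
    ; apex-unique = inner-apex
    ; tl-inj = τ-inj
    }

  module O = Bordered outer

  -- In a single triangle the state that enters through `e` is already the one that leaves through
  -- `D e`, so the path is empty.
  inner-crosses : ∀ e → Bordered.Crosses inner e (D e)
  inner-crosses (fwd zero) = ε
  inner-crosses (fwd (suc zero)) = ε
  inner-crosses (fwd (suc (suc zero))) = ε
  inner-crosses (bwd zero) = ε
  inner-crosses (bwd (suc zero)) = ε
  inner-crosses (bwd (suc (suc zero))) = ε

  out : ∀ {x y z} → Face Γ x y z → Outer x y z ⊎ Inner x y z
  out {x} {y} {z} f with allInF? x y z
  ... | yes all = inj₂ (f , all)
  ... | no ¬all = inj₁ (f , ¬all)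

  shared : ∀ {x y z z'} → Outer x y z → Inner x y z' → Σ[ e ∈ Ω6 ] (x ≡ τ e × y ≡ τ (neg e))
  shared (f , _) (_ , x∈ , y∈ , _) = in-edge a b c x∈ y∈ (proj₁ (Γ.distinct f))

  -- Views `Γ` itself as a gluing, namely of its complement of `F` with the single triangle `F`.
  module Halves (M : Ω6 → Ω6) (crosses : ∀ e → O.Crosses e (M e)) =
    Glue {Face = Face Γ} (finite-Fin (n Γ)) outer inner proj₁ proj₁ out (λ (_ , ¬F) (_ , all) → ¬F all)
      shared M D crosses inner-crosses

  monodromy : Ω6 → Ω6
  monodromy e = proj₁ (O.crosses-total (finite-Fin (n Γ)) e)

  monodromy-crosses : ∀ e → O.Crosses e (monodromy e)
  monodromy-crosses e = proj₂ (O.crosses-total (finite-Fin (n Γ)) e)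

  outer-full : ZKnotted Γ → O.Full
  outer-full = Halves.knotted⇒fullL monodromy monodromy-crosses

  ΩF : V → V → Set
  ΩF = InΩ a b c

  edge-inΩ : ∀ e → ΩF (τ e) (τ (neg e))
  edge-inΩ e = τ∈ e , τ∈ (neg e) , proj₁ (Γ.distinct (F-face e))

  outer-next : ∀ {s t} → ¬ ΩF (mid s) (lst s) → Next (Face Γ) s t → Next Outer s t
  outer-next ¬Ω (refl , refl , f , x≢) =
    refl , refl , (f , λ (v∈ , w∈ , _) → ¬Ω (v∈ , w∈ , proj₁ (Γ.distinct f))) , x≢

  next-outer-notΩ : ∀ {s t} → IsFlag Outer s → Next Outer s t → ¬ ΩF (mid s) (lst s)
  next-outer-notΩ f r (v∈ , w∈ , v≢w) with e , p , q ← in-edge a b c v∈ w∈ v≢w =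
    O.exit-stuck e (subst (λ s → Next Outer s _) (O.flag-exit e f p q) r)

  -- A state whose second edge is not in Ω(F) is followed by a face other than `F`, so the search
  -- for the first hit runs entirely in the outer piece.
  hit-star : ∀ {s t} → ¬ ΩF (mid s) (lst s) → Hit (Face Γ) a b c s t → Star (Next Outer) s t
  hit-star ¬Ω (stop r _) = outer-next ¬Ω r ◅ ε
  hit-star ¬Ω (go r ¬Ω' h) = outer-next ¬Ω r ◅ hit-star ¬Ω' h

  star-hit : ∀ {s t u} → IsFlag Outer u → Next (Face Γ) s u → Star (Next Outer) u t →
             ΩF (mid t) (lst t) → Hit (Face Γ) a b c s t
  star-hit f r ε end = stop r end
  star-hit f r (r' ◅ p) end =
    go r (next-outer-notΩ f r') (star-hit (O.next-flag r') (outer⊆ r') p end)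
    where
    outer⊆ : ∀ {s t} → Next Outer s t → Next (Face Γ) s t
    outer⊆ (p , q , f , x≢) = p , q , proj₁ f , x≢

  -- The state in which `Mon` starts: still in `F`, about to leave it through `e`.
  Inside : Ω6 → Tri V
  Inside e = third e , τ e , τ (neg e)

  leave : ∀ e {t} → Next (Face Γ) (Inside e) t → t ≡ O.enter e
  leave e (refl , refl , f , x≢) = cong (λ x → _ , _ , x) (O.apex-unique e (beyond e f x≢))

  enter-notΩ : ∀ e → ¬ ΩF (mid (O.enter e)) (lst (O.enter e))
  enter-notΩ e (v∈ , w∈ , _) = proj₂ (O.apex-face e) (τ∈ e , v∈ , w∈)

  Mon⇒crosses : ∀ e e' → Mon (Face Γ) a b c e e' → O.Crosses e e'
  Mon⇒crosses e e' (t , h , p , q)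
    rewrite tailΩ-tl a b c e | headΩ-tl a b c e | thirdΩ-opp a b c e | tailΩ-tl a b c e' | headΩ-tl a b c e'
    with h
  -- The search cannot stop at once: the edge after `e` ends at the outer apex, which is no vertex
  -- of `F`.
  ... | stop r end with refl ← leave e r = ⊥-elim (enter-notΩ e end)
  ... | go r ¬Ω h' with refl ← leave e r with path ← hit-star ¬Ω h' =
    subst (Star (Next Outer) (O.enter e)) (O.flag-exit e' (O.star-flag (O.apex-face e) path) p q) path

  crosses⇒Mon : ∀ e e' → O.Crosses e e' → Mon (Face Γ) a b c e e'
  crosses⇒Mon e e' p
    rewrite tailΩ-tl a b c e | headΩ-tl a b c e | thirdΩ-opp a b c e | tailΩ-tl a b c e' | headΩ-tl a b c e' =
    O.exit e' ,
    star-hit (O.apex-face e) (refl , refl , proj₁ (O.apex-face e) , outer-apex≢third e (O.apex-face e)) p (edge-inΩ e') ,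
    refl , refl

-- Connected sums as gluings of two outer pieces.

module Embedding {m k : ℕ} (a b c : Fin m) (p q r : Fin k)
  (abc : a ≢ b × b ≢ c × c ≢ a) (pqr : p ≢ q × q ≢ r × r ≢ p) where

  ι' : Fin k → Fin m ⊎ Fin k
  ι' = embed' a b c p q r

  ι'-view : ∀ x → (Σ[ i ∈ Fin 3 ] (x ≡ vtx p q r i × ι' x ≡ inj₁ (vtx a b c i)))
                 ⊎ (ι' x ≡ inj₂ x × ∀ i → x ≢ vtx p q r i)
  ι'-view x with x ≟ p
  ... | yes x≡p = inj₁ (zero , x≡p , refl)
  ... | no x≢p with x ≟ q
  ...   | yes x≡q = inj₁ (suc zero , x≡q , refl)
  ...   | no x≢q with x ≟ r
  ...     | yes x≡r = inj₁ (suc (suc zero) , x≡r , refl)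
  ...     | no x≢r = inj₂ (refl , λ { zero → x≢p ; (suc zero) → x≢q ; (suc (suc zero)) → x≢r })

  ι'-vtx : ∀ i → ι' (vtx p q r i) ≡ inj₁ (vtx a b c i)
  ι'-vtx i with ι'-view (vtx p q r i)
  ... | inj₂ (_ , ≢) = ⊥-elim (≢ i refl)
  ... | inj₁ (j , e , eq) with refl ← vtx-inj p q r pqr i j e = eq

  -- The two vertex sets meet only in the identified triangle; hence the pieces share no face, and
  -- share only border edges.
  ι'-meet : ∀ x {y} → inj₁ y ≡ ι' x → InTri a b c y
  ι'-meet x eq with ι'-view x
  ... | inj₁ (i , refl , eq') with refl ← trans eq eq' = vtx-in a b c i
  ... | inj₂ (eq' , _) with () ← trans eq eq'

  ι'-inj : ∀ {x y} → ι' x ≡ ι' y → x ≡ y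
  ι'-inj {x} {y} eq with ι'-view x | ι'-view y
  ... | inj₁ (i , x≡ , e) | inj₁ (j , y≡ , e')
    with refl ← vtx-inj a b c abc i j (inj₁-injective (trans (sym e) (trans eq e'))) = trans x≡ (sym y≡)
  ... | inj₁ (_ , _ , e) | inj₂ (e' , _) with () ← trans (sym e) (trans eq e')
  ... | inj₂ (e , _) | inj₁ (_ , _ , e') with () ← trans (sym e) (trans eq e')
  ... | inj₂ (e , _) | inj₂ (e' , _) = inj₂-injective (trans (sym e) (trans eq e'))

module ConnectedSum (Γ Γ' : Triangulation) {a b c : Fin (n Γ)} {p q r : Fin (n Γ')}
  (F : Face Γ a b c) (F' : Face Γ' p q r) where

  module C = Cut Γ F
  module C' = Cut Γ' F'
  open Embedding a b c p q r (Triangulation.distinct Γ F) (Triangulation.distinct Γ' F')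

  private
    module Left = Transport {W = Fin (n Γ) ⊎ Fin (n Γ')} C.outer inj₁ inj₁-injective (inj₁ ∘ C.τ) (λ _ → refl)
    module Right = Transport C'.outer ι' ι'-inj (inj₁ ∘ C.τ) (λ e → sym (ι'-vtx (start e)))

    Sum' : Fin (n Γ) ⊎ Fin (n Γ') → Fin (n Γ) ⊎ Fin (n Γ') → Fin (n Γ) ⊎ Fin (n Γ') → Set
    Sum' = SumFace Γ Γ' a b c p q r

    out : ∀ {x y z} → Sum' x y z → Left.Image x y z ⊎ Right.Image x y z
    out (inj₁ (t , f , ¬F , eqs)) = inj₁ (t , (f , ¬F) , eqs)
    out (inj₂ (t , f , ¬F , eqs)) = inj₂ (t , (f , ¬F) , eqs)

    disjoint : ∀ {x y z} → Left.Image x y z → ¬ Right.Image x y z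
    disjoint (_ , (_ , ¬F) , refl , refl , refl) ((x , y , z) , _ , e₁ , e₂ , e₃) =
      ¬F (ι'-meet x e₁ , ι'-meet y e₂ , ι'-meet z e₃)

    shared : ∀ {x y z z'} → Left.Image x y z → Right.Image x y z' →
             Σ[ e ∈ Ω6 ] (x ≡ inj₁ (C.τ e) × y ≡ inj₁ (C.τ (neg e)))
    shared (_ , (f , _) , refl , refl , refl) ((x , y , _) , _ , e₁ , e₂ , _)
      with e , refl , refl ← in-edge a b c (ι'-meet x e₁) (ι'-meet y e₂) (proj₁ (Triangulation.distinct Γ f)) =
        e , refl , refl

  module _ (M M' : Ω6 → Ω6) (crosses : ∀ e → C.O.Crosses e (M e)) (crosses' : ∀ e → C'.O.Crosses e (M' e)) where

    private
      module G = Glue {Face = Sum'} finite-⊎ Left.bordered Right.bordered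
        (λ (t , (f , ¬F) , eqs) → inj₁ (t , f , ¬F , eqs)) (λ (t , (f , ¬F) , eqs) → inj₂ (t , f , ¬F , eqs))
        out disjoint shared M M'
        (λ e → Left.crosses-image e (M e) (crosses e)) (λ e → Right.crosses-image e (M' e) (crosses' e))

    sum-spans : zKnotted Sum' → ∀ d → Spans M M' d
    sum-spans = G.knotted⇒spans

    sum-knotted : ZKnotted Γ → ZKnotted Γ' → ∀ d → Spans M M' d → zKnotted Sum'
    sum-knotted k k' = G.spans⇒knotted (Left.full-image (C.outer-full k)) (Right.full-image (C'.outer-full k'))

-- Decidable conditions on the maps of the six edges.

_≟Ω_ : (e e' : Ω6) → Dec (e ≡ e')
fwd i ≟Ω fwd j = map′ (cong fwd) (λ { refl → refl }) (i ≟ j)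
bwd i ≟Ω bwd j = map′ (cong bwd) (λ { refl → refl }) (i ≟ j)
fwd _ ≟Ω bwd _ = no λ ()
bwd _ ≟Ω fwd _ = no λ ()

open import Data.List.Membership.DecPropositional _≟Ω_ using () renaming (_∈?_ to _∈Ω?_)
open import Data.List.Membership.DecPropositional (≡-dec _≟Ω_ _≟Ω_) using () renaming (_∈?_ to _∈C?_)

∀Ω? : {P : Ω6 → Set} → (∀ e → Dec (P e)) → Dec (∀ e → P e)
∀Ω? P? = map′ (λ { (f , g) (fwd i) → f i ; (f , g) (bwd i) → g i }) (λ h → (h ∘ fwd) , (h ∘ bwd))
  (all? (P? ∘ fwd) ×-dec all? (P? ∘ bwd))

∃Ω? : {P : Ω6 → Set} → (∀ e → Dec (P e)) → Dec (Σ[ e ∈ Ω6 ] P e)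
∃Ω? P? = map′ (λ { (inj₁ (i , p)) → fwd i , p ; (inj₂ (i , p)) → bwd i , p })
  (λ { (fwd i , p) → inj₁ (i , p) ; (bwd i , p) → inj₂ (i , p) })
  (any? (P? ∘ fwd) ⊎-dec any? (P? ∘ bwd))

∀C? : {P : Crossing → Set} → (∀ c → Dec (P c)) → Dec (∀ c → P c)
∀C? P? = map′ (λ { (f , g) (inj₁ e) → f e ; (f , g) (inj₂ e) → g e }) (λ h → (h ∘ inj₁) , (h ∘ inj₂))
  (∀Ω? (P? ∘ inj₁) ×-dec ∀Ω? (P? ∘ inj₂))

base : Crossing
base = inj₁ (fwd zero)

-- Twelve iterates exhaust an orbit, as there are twelve crossings.
Visited : (Ω6 → Ω6) → (Ω6 → Ω6) → Crossing → Set
Visited M N d = d ∈ iterate (turn M N) base 12 ⊎ d ∈ iterate (turn M N) (opposite base) 12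

AllVisited VisitedClosed : (Ω6 → Ω6) → (Ω6 → Ω6) → Set
AllVisited M N = ∀ d → Visited M N d
VisitedClosed M N = ∀ d → Visited M N d → Visited M N (turn M N d)

visited? : ∀ M N d → Dec (Visited M N d)
visited? M N d = (d ∈C? _) ⊎-dec (d ∈C? _)

allVisited? : ∀ M N → Dec (AllVisited M N)
allVisited? M N = ∀C? (visited? M N)

visitedClosed? : ∀ M N → Dec (VisitedClosed M N)
visitedClosed? M N = ∀C? λ d → visited? M N d →-dec visited? M N (turn M N d)

iterate-reach : ∀ {M N} k {c d} → d ∈ iterate (turn M N) c k → Reach M N c d
iterate-reach (suc k) (here refl) = ε
iterate-reach (suc k) (there p) = refl ◅ iterate-reach k p

visited⇒spans : ∀ M N → AllVisited M N → Spans M N base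
visited⇒spans M N all d = Sum.map (iterate-reach 12) (iterate-reach 12) (all d)

-- Paths of `Reach` have no length bound; closure under `turn` keeps each of them inside the two
-- finite lists.
spans⇒visited : ∀ M N → VisitedClosed M N → Spans M N base → AllVisited M N
spans⇒visited M N closed sp d =
  Sum.[ follow (inj₁ (here refl)) , follow (inj₂ (here refl)) ] (sp d)
  where
  follow : ∀ {c} → Visited M N c → Reach M N c d → Visited M N d
  follow v ε = v
  follow v (refl ◅ p) = follow (closed _ v) p

tableM3 tableM4 : Ω6 → List (Ω6 × Ω6)
tableM3 e₁ = let e₂ = D e₁ ; e₃ = D e₂ in
  (neg e₁ , e₂) ∷ (e₂ , e₃) ∷ (e₃ , neg e₁) ∷ (neg e₃ , neg e₂) ∷ (neg e₂ , e₁) ∷ (e₁ , neg e₃) ∷ []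
tableM4 e₁ = let e₂ = D e₁ ; e₃ = D e₂ in
  (e₁ , neg e₂) ∷ (neg e₂ , e₁) ∷ (e₂ , neg e₁) ∷ (neg e₁ , e₂) ∷ (e₃ , e₃) ∷ (neg e₃ , neg e₃) ∷ []

value : List (Ω6 × Ω6) → Ω6 → Ω6
-- A default value, never taken for the two tables above, which cover all six edges.
value [] x = x
value ((y , z) ∷ t) x = if does (x ≟Ω y) then z else value t x

value-all : (R : Ω6 → Ω6 → Set) → ∀ {t x} → All (uncurry R) t → x ∈ map proj₁ t → R x (value t x)
value-all R {x = x} (_∷_ {y , z} r rs) x∈ with x ≟Ω y
... | yes refl = r
value-all R (r ∷ rs) (here x≡y) | no x≢y = ⊥-elim (x≢y x≡y)
value-all R (r ∷ rs) (there x∈) | no _ = value-all R rs x∈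

Covers : (Ω6 → List (Ω6 × Ω6)) → Set
Covers table = ∀ e₁ x → x ∈ map proj₁ (table e₁)

covers? : ∀ table → Dec (Covers table)
covers? table = ∀Ω? λ e₁ → ∀Ω? λ x → x ∈Ω? map proj₁ (table e₁)

abstract
  coversM3 : Covers tableM3
  coversM3 = toWitness {a? = covers? tableM3} _

  coversM4 : Covers tableM4
  coversM4 = toWitness {a? = covers? tableM4} _

-- Listing the six values turns quantification over all maps of edges into six quantifiers over
-- `Ω6`, which can be decided.
tabulated : Ω6 → Ω6 → Ω6 → Ω6 → Ω6 → Ω6 → Ω6 → Ω6
tabulated x y z x' y' z' (fwd zero) = x
tabulated x y z x' y' z' (fwd (suc zero)) = y
tabulated x y z x' y' z' (fwd (suc (suc zero))) = z
tabulated x y z x' y' z' (bwd zero) = x'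
tabulated x y z x' y' z' (bwd (suc zero)) = y'
tabulated x y z x' y' z' (bwd (suc (suc zero))) = z'

IsM3 : (Ω6 → Ω6) → Set
IsM3 M = Σ[ e₁ ∈ Ω6 ] All (λ (x , y) → M x ≡ y) (tableM3 e₁)

-- The two premises are what reversal of arcs gives. The second makes `M` injective, so both turn
-- maps permute the twelve crossings and the lists of visited ones are closed.
Classified : (Ω6 → Ω6) → Set
Classified M = (∀ e → M e ≢ neg e) → (∀ e → M (neg (M e)) ≡ neg e) →
  (VisitedClosed M D × VisitedClosed id M) × (AllVisited M D → AllVisited id M → (∀ e → M e ≡ D e) ⊎ IsM3 M)

classified? : ∀ M → Dec (Classified M)
classified? M = ∀Ω? (λ e → ¬? (M e ≟Ω neg e)) →-dec ∀Ω? (λ e → M (neg (M e)) ≟Ω neg e) →-dec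
  (visitedClosed? M D ×-dec visitedClosed? id M) ×-dec
  (allVisited? M D →-dec allVisited? id M →-dec
    (∀Ω? (λ e → M e ≟Ω D e) ⊎-dec ∃Ω? (λ e₁ → All.all? (λ (x , y) → M x ≟Ω y) (tableM3 e₁))))

abstract
  classification : ∀ x y z x' y' z' → Classified (tabulated x y z x' y' z')
  classification = toWitness {a? = ∀Ω? λ x → ∀Ω? λ y → ∀Ω? λ z → ∀Ω? λ x' → ∀Ω? λ y' → ∀Ω? λ z' →
    classified? (tabulated x y z x' y' z')} _

  id-D-visited : AllVisited id D
  id-D-visited = toWitness {a? = allVisited? id D} _

  id-M3-visited : ∀ e₁ → AllVisited id (value (tableM3 e₁))
  id-M3-visited = toWitness {a? = ∀Ω? λ e₁ → allVisited? id (value (tableM3 e₁))} _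

-- Cyclic relabelling of a face.

rot unrot : Ω6 → Ω6
rot (fwd i) = fwd (s3 i)
rot (bwd i) = bwd (s3 i)
unrot (fwd i) = fwd (p3 i)
unrot (bwd i) = bwd (p3 i)

-- The edge called `e` in the labelling q, r, p is `rot e` in p, q, r, so a change of labelling
-- conjugates the z-monodromy.
rotated : (Ω6 → Ω6) → Ω6 → Ω6
rotated M = unrot ∘ M ∘ rot

SomeRotation : (Ω6 → Ω6) → (Ω6 → Ω6) → Set
SomeRotation M N = AllVisited M N ⊎ AllVisited M (rotated N) ⊎ AllVisited M (rotated (rotated N))

abstract
  -- A check of 144 cases: two types and six choices of the distinguished edge for each face.
  rotation-visited : ∀ {t t'} → t ∈ tableM3 ∷ tableM4 ∷ [] → t' ∈ tableM3 ∷ tableM4 ∷ [] →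
    ∀ e₁ e₁' → SomeRotation (value (t e₁)) (value (t' e₁'))
  rotation-visited p q = All.lookup (All.lookup (toWitness {a? = check} _) p) q
    where
    check : Dec (All (λ t → All (λ t' → ∀ e₁ e₁' → SomeRotation (value (t e₁)) (value (t' e₁'))) (tableM3 ∷ tableM4 ∷ []))
                   (tableM3 ∷ tableM4 ∷ []))
    check = All.all? (λ t → All.all? (λ t' → ∀Ω? λ e₁ → ∀Ω? λ e₁' →
      let M = value (t e₁) ; N = value (t' e₁') in
      allVisited? M N ⊎-dec allVisited? M (rotated N) ⊎-dec allVisited? M (rotated (rotated N))) _) _

-- Agrees with `M` at every edge, but has the form to which `classification` applies.
retabulate : (Ω6 → Ω6) → Ω6 → Ω6
retabulate M = tabulated (M (fwd zero)) (M (fwd (suc zero))) (M (fwd (suc (suc zero))))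
                         (M (bwd zero)) (M (bwd (suc zero))) (M (bwd (suc (suc zero))))

retabulate-related : (R : Ω6 → Ω6 → Set) (M : Ω6 → Ω6) → (∀ e → R e (M e)) → ∀ e → R e (retabulate M e)
retabulate-related R M r (fwd zero) = r (fwd zero)
retabulate-related R M r (fwd (suc zero)) = r (fwd (suc zero))
retabulate-related R M r (fwd (suc (suc zero))) = r (fwd (suc (suc zero)))
retabulate-related R M r (bwd zero) = r (bwd zero)
retabulate-related R M r (bwd (suc zero)) = r (bwd (suc zero))
retabulate-related R M r (bwd (suc (suc zero))) = r (bwd (suc (suc zero)))

rot-unrot : ∀ e → rot (unrot e) ≡ e
rot-unrot (fwd zero) = refl
rot-unrot (fwd (suc zero)) = refl
rot-unrot (fwd (suc (suc zero))) = refl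
rot-unrot (bwd zero) = refl
rot-unrot (bwd (suc zero)) = refl
rot-unrot (bwd (suc (suc zero))) = refl

module _ {V : Set} {p q r : V} where

  inTri-rot : ∀ {x} → InTri p q r x → InTri q r p x
  inTri-rot (inj₁ e) = inj₂ (inj₂ e)
  inTri-rot (inj₂ (inj₁ e)) = inj₁ e
  inTri-rot (inj₂ (inj₂ e)) = inj₂ (inj₁ e)

  inTri-unrot : ∀ {x} → InTri q r p x → InTri p q r x
  inTri-unrot (inj₁ e) = inj₂ (inj₁ e)
  inTri-unrot (inj₂ (inj₁ e)) = inj₂ (inj₂ e)
  inTri-unrot (inj₂ (inj₂ e)) = inj₁ e

  hit-rot : ∀ {Face s t} → Hit Face p q r s t → Hit Face q r p s t
  hit-rot (stop r (x∈ , y∈ , x≢y)) = stop r (inTri-rot x∈ , inTri-rot y∈ , x≢y)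
  hit-rot (go r ¬Ω h) = go r (λ (x∈ , y∈ , x≢y) → ¬Ω (inTri-unrot x∈ , inTri-unrot y∈ , x≢y)) (hit-rot h)

  vtx-rot : ∀ i → vtx p q r (s3 i) ≡ vtx q r p i
  vtx-rot zero = refl
  vtx-rot (suc zero) = refl
  vtx-rot (suc (suc zero)) = refl

  tailΩ-rot : ∀ e → tailΩ p q r (rot e) ≡ tailΩ q r p e
  tailΩ-rot (fwd i) = vtx-rot i
  tailΩ-rot (bwd i) = vtx-rot (s3 i)

  headΩ-rot : ∀ e → headΩ p q r (rot e) ≡ headΩ q r p e
  headΩ-rot (fwd i) = vtx-rot (s3 i)
  headΩ-rot (bwd i) = vtx-rot i

  thirdΩ-rot : ∀ e → thirdΩ p q r (rot e) ≡ thirdΩ q r p e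
  thirdΩ-rot (fwd i) = vtx-rot (s3 (s3 i))
  thirdΩ-rot (bwd i) = vtx-rot (s3 (s3 i))

  -- Membership in Ω(F) ignores the order of the three vertices, so the first hit stays the same and
  -- only names of edges change.
  Mon-rot : ∀ {Face} e e' → Mon Face p q r (rot e) (rot e') → Mon Face q r p e e'
  Mon-rot e e' m
    rewrite tailΩ-rot e | headΩ-rot e | thirdΩ-rot e | tailΩ-rot e' | headΩ-rot e'
    with t , h , eqs ← m = t , hit-rot h , eqs

  Mon-rotated : ∀ {Face} N → (∀ e → Mon Face p q r e (N e)) → ∀ e → Mon Face q r p e (rotated N e)
  Mon-rotated {Face} N m e =
    Mon-rot e (rotated N e) (subst (Mon Face p q r (rot e)) (sym (rot-unrot (N (rot e)))) (m (rot e)))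

-- From z-monodromy types to z-knotted connected sums.

module _ {V : Set} {Face : V → V → V → Set} {a b c : V} where

  typeM3-value : (τ : TypeM3 Face a b c) → ∀ e → Mon Face a b c e (value (tableM3 (proj₁ τ)) e)
  typeM3-value (e₁ , m₁ , m₂ , m₃ , m₄ , m₅ , m₆) e =
    value-all (Mon Face a b c) {t = tableM3 e₁} (m₁ ∷ m₂ ∷ m₃ ∷ m₄ ∷ m₅ ∷ m₆ ∷ []) (coversM3 e₁ e)

  typeM4-value : (τ : TypeM4 Face a b c) → ∀ e → Mon Face a b c e (value (tableM4 (proj₁ τ)) e)
  typeM4-value (e₁ , m₁ , m₂ , m₃ , m₄ , m₅ , m₆) e =
    value-all (Mon Face a b c) {t = tableM4 e₁} (m₁ ∷ m₂ ∷ m₃ ∷ m₄ ∷ m₅ ∷ m₆ ∷ []) (coversM4 e₁ e)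

  type-value : TypeM3 Face a b c ⊎ TypeM4 Face a b c →
    Σ[ table ∈ (Ω6 → List (Ω6 × Ω6)) ] (table ∈ tableM3 ∷ tableM4 ∷ [] ×
      (Σ[ e₁ ∈ Ω6 ] (∀ e → Mon Face a b c e (value (table e₁) e))))
  type-value (inj₁ τ) = tableM3 , here refl , proj₁ τ , typeM3-value τ
  type-value (inj₂ τ) = tableM4 , there (here refl) , proj₁ τ , typeM4-value τ

module _ (Γ Γ' : Triangulation) (k : ZKnotted Γ) (k' : ZKnotted Γ') where

  module _ {a b c : Fin (n Γ)} {p q r : Fin (n Γ')} (F : Face Γ a b c) (F' : Face Γ' p q r) where

    open ConnectedSum Γ Γ' F F'

    visited⇒knotted : ∀ M M' → (∀ e → Mon (Face Γ) a b c e (M e)) → (∀ e → Mon (Face Γ') p q r e (M' e)) →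
      AllVisited M M' → zKnotted (SumFace Γ Γ' a b c p q r)
    visited⇒knotted M M' m m' v =
      sum-knotted M M' (λ e → C.Mon⇒crosses e (M e) (m e)) (λ e → C'.Mon⇒crosses e (M' e) (m' e))
        k k' base (visited⇒spans M M' v)

    -- With M_F = D_F the outer piece of `Γ` acts on crossings as a single triangle does. The
    -- crossings of the sum are thus permuted as those of `Γ'` cut along `F'`, with the sides
    -- exchanged.
    D⇒knotted : MisD (Face Γ) a b c → zKnotted (SumFace Γ Γ' a b c p q r)
    D⇒knotted m = sum-knotted D C'.monodromy (λ e → C.Mon⇒crosses e (D e) (m e)) C'.monodromy-crosses k k' (inj₂ (fwd zero))
      (spans-swap (C'.Halves.knotted⇒spans C'.monodromy C'.monodromy-crosses k' base))

    -- That `Γ'` is z-knotted gives one orbit for the pair of `M` and `D`; that the sum is gives one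
    -- orbit for `id` and `M`. The classification leaves only the two stated forms of `M`.
    id-knotted⇒type : MisId (Face Γ) a b c → zKnotted (SumFace Γ Γ' a b c p q r) →
      MisD (Face Γ') p q r ⊎ TypeM3 (Face Γ') p q r
    id-knotted⇒type m ks = conclude (proj₂ classified
      (spans⇒visited M D (proj₁ (proj₁ classified)) (C'.Halves.knotted⇒spans M crosses k' base))
      (spans⇒visited id M (proj₂ (proj₁ classified)) (sum-spans id M (λ e → C.Mon⇒crosses e e (m e)) crosses ks base)))
      where
      μ M : Ω6 → Ω6
      μ = C'.monodromy
      M = retabulate μ
      crosses : ∀ e → C'.O.Crosses e (M e)
      crosses = retabulate-related C'.O.Crosses μ C'.monodromy-crosses
      classified : (VisitedClosed M D × VisitedClosed id M) × (AllVisited M D → AllVisited id M → (∀ e → M e ≡ D e) ⊎ IsM3 M)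
      classified = classification (μ (fwd zero)) (μ (fwd (suc zero))) (μ (fwd (suc (suc zero))))
                                  (μ (bwd zero)) (μ (bwd (suc zero))) (μ (bwd (suc (suc zero))))
        (λ e eq → C'.O.crosses-not-neg e (subst (C'.O.Crosses e) eq (crosses e)))
        (λ e → C'.O.crosses-functional (neg (M e)) (crosses (neg (M e))) (C'.O.crosses-neg e (M e) (crosses e)))
      mon : ∀ {e e'} → M e ≡ e' → Mon (Face Γ') p q r e e'
      mon {e} refl = C'.crosses⇒Mon e (M e) (crosses e)
      conclude : (∀ e → M e ≡ D e) ⊎ IsM3 M → MisD (Face Γ') p q r ⊎ TypeM3 (Face Γ') p q r
      conclude (inj₁ eq) = inj₁ (λ e → mon (eq e))
      conclude (inj₂ (e₁ , q₁ ∷ q₂ ∷ q₃ ∷ q₄ ∷ q₅ ∷ q₆ ∷ [])) =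
        inj₂ (e₁ , mon q₁ , mon q₂ , mon q₃ , mon q₄ , mon q₅ , mon q₆)

    id-type⇒knotted : MisId (Face Γ) a b c → MisD (Face Γ') p q r ⊎ TypeM3 (Face Γ') p q r →
      zKnotted (SumFace Γ Γ' a b c p q r)
    id-type⇒knotted m (inj₁ m') = visited⇒knotted id D m m' id-D-visited
    id-type⇒knotted m (inj₂ τ) = visited⇒knotted id (value (tableM3 (proj₁ τ))) m (typeM3-value τ) (id-M3-visited (proj₁ τ))

  -- A special homeomorphism is an ordering of the vertices of `F'` matched with a, b, c; it is
  -- chosen among the three rotations of p, q, r.
  some-rotation-knotted : {a b c : Fin (n Γ)} {p q r : Fin (n Γ')} → Face Γ a b c → Face Γ' p q r →
    TypeM3 (Face Γ) a b c ⊎ TypeM4 (Face Γ) a b c →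
    TypeM3 (Face Γ') p q r ⊎ TypeM4 (Face Γ') p q r →
    Σ[ p' ∈ Fin (n Γ') ] Σ[ q' ∈ Fin (n Γ') ] Σ[ r' ∈ Fin (n Γ') ]
      (Face Γ' p' q' r' × SameTri p q r p' q' r' × zKnotted (SumFace Γ Γ' a b c p' q' r'))
  some-rotation-knotted {p = p} {q} {r} F F' τ τ'
    with t , t∈ , e₁ , m ← type-value τ | t' , t∈' , e₁' , m' ← type-value τ'
    with rotation-visited t∈ t∈' e₁ e₁'
  ... | inj₁ v = p , q , r , F' , (inj₁ refl , inj₂ (inj₁ refl) , inj₂ (inj₂ refl)) ,
    visited⇒knotted F F' (value (t e₁)) (value (t' e₁')) m m' v
  ... | inj₂ (inj₁ v) = q , r , p , F'' , (inj₂ (inj₁ refl) , inj₂ (inj₂ refl) , inj₁ refl) ,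
    visited⇒knotted F F'' M (rotated N) m (Mon-rotated N m') v
    where
    M = value (t e₁)
    N = value (t' e₁')
    F'' = Triangulation.rotate Γ' F'
  ... | inj₂ (inj₂ v) = r , p , q , F'' , (inj₂ (inj₂ refl) , inj₁ refl , inj₂ (inj₁ refl)) ,
    visited⇒knotted F F'' M (rotated (rotated N)) m (Mon-rotated (rotated N) (Mon-rotated N m')) v
    where
    M = value (t e₁)
    N = value (t' e₁')
    F'' = Triangulation.rotate Γ' (Triangulation.rotate Γ' F')

theorem4 : (Γ Γ' : Triangulation) → ZKnotted Γ → ZKnotted Γ' →
    -- (1) M_F = D_F  ⇒  Γ #_g Γ' z-knotted for every F' and every g
    ((a b c : Fin (n Γ)) → Face Γ a b c → MisD (Face Γ) a b c →
       (p q r : Fin (n Γ')) → Face Γ' p q r →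
       zKnotted (SumFace Γ Γ' a b c p q r))
    -- (2) M_F = id
    × ((a b c : Fin (n Γ)) → Face Γ a b c → MisId (Face Γ) a b c →
       ((p q r : Fin (n Γ')) → Face Γ' p q r →
          zKnotted (SumFace Γ Γ' a b c p q r) →
          MisD (Face Γ') p q r ⊎ TypeM3 (Face Γ') p q r)
       × ((p q r : Fin (n Γ')) → Face Γ' p q r →
          MisD (Face Γ') p q r ⊎ TypeM3 (Face Γ') p q r →
          zKnotted (SumFace Γ Γ' a b c p q r)))
    -- (3) M_F, M_F' of type (M3) or (M4)  ⇒  some g works
    × ((a b c : Fin (n Γ)) → Face Γ a b c → (p q r : Fin (n Γ')) → Face Γ' p q r →
       TypeM3 (Face Γ) a b c ⊎ TypeM4 (Face Γ) a b c →
       TypeM3 (Face Γ') p q r ⊎ TypeM4 (Face Γ') p q r →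
       Σ[ p' ∈ Fin (n Γ') ] Σ[ q' ∈ Fin (n Γ') ] Σ[ r' ∈ Fin (n Γ') ]
         (Face Γ' p' q' r' × SameTri p q r p' q' r'
          × zKnotted (SumFace Γ Γ' a b c p' q' r')))
theorem4 Γ Γ' k k' =
    (λ a b c F m p q r F' → D⇒knotted Γ Γ' k k' F F' m)
  , (λ a b c F m → (λ p q r F' → id-knotted⇒type Γ Γ' k k' F F' m) , (λ p q r F' → id-type⇒knotted Γ Γ' k k' F F' m))
  , (λ a b c F p q r F' → some-rotation-knotted Γ Γ' k k' F F')
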